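{- Let $t,\omega$ be integers with $\omega\geq 6$ and $t\geq\omega+1$. Then $$(\omega-1)(t-1)+1\leq \operatorname{gr}_4(P_5:PA_{t,\omega})\leq 3\operatorname{R}_2(PA_{t,\omega})-2 .$$
   Context: All graphs are finite, simple and undirected. $K_n$ is the complete graph on $n$ vertices and $P_5$ is the path with $5$ vertices and $4$ edges. For $t\geq\omega+1$, the pineapple $PA_{t,\omega}$ is the graph of order $t$ obtained from the complete graph $K_\omega$ by attaching $t-\omega$ pendent vertices to one and the same vertex of $K_\omega$. An edge-colored graph is rainbow if all its edges have different colors and monochromatic if all its edges have a single color. A copy of a graph means a (not necessarily induced) subgraph isomorphic to it. $\operatorname{R}_2(H)$ is the classical two-color Ramsey number: the minimum $n$ such that every coloring of the edges of $K_n$ with two colors contains a monochromatic copy of $H$. In the definition of Gallai-Ramsey numbers, a $k$-edge-coloring assigns to each edge one of $k$ colors and is assumed exact, i.e. each of the $k$ colors is used at least once. For non-empty graphs $G,H$ (graphs with at least one edge) and a positive integer $k$, the Gallai-Ramsey number $\operatorname{gr}_k(G:H)$ is the minimum integer $N$ with $\binom{N}{2}\geq k$ (so that $K_N$ admits a $k$-edge-coloring) such that for all $n\geq N$, every $k$-edge-coloring of $K_n$ contains either a rainbow copy of $G$ or a monochromatic copy of $H$. -}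

module Defs where

open import Level using (0ℓ)
open import Data.Nat using (ℕ; suc; _≤_; _<_; _≥_; _<?_; _≤?_)
import Data.Nat as ℕ
open import Data.Nat.Properties using (1+n≢n)
open import Data.Nat.Combinatorics using (_C_)
open import Data.Fin using (Fin; toℕ; _≟_)
open import Data.Product using (Σ-syntax; ∃-syntax; _×_; _,_; swap)
open import Data.Sum using (_⊎_; inj₁; inj₂)
import Data.Sum as Sum
open import Function using (_∘_)
open import Function.Definitions using (Injective)
open import Relation.Nullary using (¬_; ¬?; _×-dec_; _⊎-dec_)
open import Relation.Binary using (Rel; Decidable; Symmetric; Irreflexive)
open import Relation.Binary.PropositionalEquality using (_≡_; _≢_; refl; sym)

record Graph : Set₁ where
  field
    order  : ℕ
    Adj    : Rel (Fin order) 0ℓ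
    adj?   : Decidable Adj
    symm   : Symmetric Adj
    irrefl : Irreflexive _≡_ Adj

path : ℕ → Graph
path n = record
  { order  = n
  ; Adj    = λ u v → suc (toℕ u) ≡ toℕ v ⊎ suc (toℕ v) ≡ toℕ u
  ; adj?   = λ u v → (suc (toℕ u) ℕ.≟ toℕ v) ⊎-dec (suc (toℕ v) ℕ.≟ toℕ u)
  ; symm   = Sum.swap
  ; irrefl = λ { refl (inj₁ e) → 1+n≢n e ; refl (inj₂ e) → 1+n≢n e }
  }

-- Vertices 0, …, ω - 1 form the clique; the pendent vertices ω, …, t - 1 are
-- all attached to vertex 0.  This is the pineapple when 1 ≤ ω < t.
pineapple : (t ω : ℕ) → Graph
pineapple t ω = record
  { order  = t
  ; Adj    = λ u v → u ≢ v × (Clique u v ⊎ Pendent u v ⊎ Pendent v u)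
  ; adj?   = λ u v → ¬? (u ≟ v) ×-dec
               (((toℕ u <? ω) ×-dec (toℕ v <? ω)) ⊎-dec
                (pendent? u v ⊎-dec pendent? v u))
  ; symm   = λ { (u≢v , e) → u≢v ∘ sym , Sum.map swap Sum.swap e }
  ; irrefl = λ { u≡v (u≢v , _) → u≢v u≡v }
  }
  where
  Clique Pendent : Rel (Fin t) 0ℓ
  Clique  u v = toℕ u < ω × toℕ v < ω
  Pendent u v = toℕ u ≡ 0 × ω ≤ toℕ v

  pendent? : Decidable Pendent
  pendent? u v = (toℕ u ℕ.≟ 0) ×-dec (ω ≤? toℕ v)

-- A colouring of the edges of Kₙ with k colours, not necessarily all used.
-- The values colour u u carry no meaning: every notion below only looks at
-- colour u v for u ≢ v.
record EdgeColouring (n k : ℕ) : Set where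
  field
    colour : Fin n → Fin n → Fin k
    symm   : ∀ u v → colour u v ≡ colour v u

open EdgeColouring using (colour)

Exact : ∀ {n k} → EdgeColouring n k → Set
Exact {n} {k} c = ∀ (i : Fin k) → ∃[ u ] ∃[ v ] (u ≢ v × colour c u v ≡ i)

-- A copy of H in Kₙ is given by an injection of its vertices; the images of
-- edges of H are then automatically edges of Kₙ.
Copy : Graph → ℕ → Set
Copy H n = Σ[ φ ∈ (Fin (Graph.order H) → Fin n) ] Injective _≡_ _≡_ φ

module _ {n k} (c : EdgeColouring n k) (H : Graph) where
  open Graph H

  Monochromatic : Copy H n → Set
  Monochromatic (φ , _) =
    ∃[ i ] (∀ u v → Adj u v → colour c (φ u) (φ v) ≡ i)

  -- Edges of H are unordered pairs, so uv and xy are the same edge when they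
  -- agree up to a swap.
  Rainbow : Copy H n → Set
  Rainbow (φ , _) =
    ∀ u v x y → Adj u v → Adj x y →
    colour c (φ u) (φ v) ≡ colour c (φ x) (φ y) →
    (u ≡ x × v ≡ y) ⊎ (u ≡ y × v ≡ x)

  HasMonochromaticCopy : Set
  HasMonochromaticCopy = ∃[ f ] Monochromatic f

  HasRainbowCopy : Set
  HasRainbowCopy = ∃[ f ] Rainbow f

IsMinimum : (ℕ → Set) → ℕ → Set
IsMinimum P n = P n × (∀ m → P m → n ≤ m)

IsR₂ : Graph → ℕ → Set
IsR₂ H = IsMinimum λ n → ∀ (c : EdgeColouring n 2) → HasMonochromaticCopy c H

Isgr : (k : ℕ) (G H : Graph) → ℕ → Set
Isgr k G H = IsMinimum λ N →
  k ≤ N C 2 ×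
  (∀ n → n ≥ N → ∀ (c : EdgeColouring n k) → Exact c →
    HasRainbowCopy c G ⊎ HasMonochromaticCopy c H)

-- Lower bound: ω − 1 blocks of t − 1 vertices, monochromatic inside in the
-- colours 1, 2, 3 and joined by colour 0, contain neither K_ω in colour 0 nor a
-- connected graph on t vertices in another colour; two consecutive edges of a
-- rainbow path cannot both lie inside blocks, so two of its four edges would
-- have colour 0.
--
-- Upper bound: suppose there is no rainbow P₅.  If every vertex sees at most two
-- colours, the colour sets of the vertices pairwise intersect and cover four
-- colours, so they share a colour α.  Classifying vertices by their other colour
-- gives three classes that use two colours each, one of which has R₂ vertices.
-- Otherwise some vertex v sees three colours, and together with an edge pq of the
-- fourth colour this yields a rainbow star, a rainbow paw, or a rainbow fork in
-- which vp and vq have the same colour.  On five vertices each of these contains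
-- a rainbow paw, and for a rainbow paw with pendent vertex b and two further
-- vertices x, y the edges bx and xy have the same colour.  Hence everything
-- outside the paw is monochromatic.
module Submission where

open import Data.Bool using (true; false)
open import Data.Nat using (ℕ; zero; suc; _+_; _*_; _∸_; _≤_; _<_; _≥_; z≤n; s≤s; s≤s⁻¹; z<s; _≤?_; _<?_)
open import Data.Nat.Properties
  using (≤-refl; ≤-trans; ≮⇒≥; ≰⇒>; m≤m+n; m≤n+m; n≤1+n; 1+n≰n; +-mono-≤; +-suc; +-comm; *-suc; allUpTo?; module ≤-Reasoning)
open import Data.Nat.Combinatorics using (_C_; nC1≡n; nCk+nC[k+1]≡[n+1]C[k+1])
open import Data.Fin
  using (Fin; zero; suc; toℕ; inject≤; _≟_; punchIn; punchOut; lift; splitAt; join; combine; remQuot)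
open import Data.Fin.Patterns using (0F; 1F; 2F; 3F; 4F; 5F)
open import Data.Fin.Properties
  using (any?; all?; ¬∀⟶∃¬; suc-injective; punchOut-injective; lift-injective; injective⇒≤; join-splitAt;
         combine-remQuot; remQuot-combine; inject≤-injective; toℕ-inject≤; toℕ<n)
open import Data.List as List using (List; []; _∷_; _++_; allFin; concatMap; filter)
open import Data.List.Membership.Propositional using (_∈_)
open import Data.List.Membership.Propositional.Properties using (∈-allFin)
open import Data.List.Relation.Unary.All as All using (All; []; _∷_)
import Data.List.Relation.Unary.All.Properties as All
open import Data.List.Relation.Unary.Any as Any using (Any; here)
open import Data.Maybe using (Maybe; just; nothing)
import Data.Maybe.Properties as Maybe
open import Data.Product using (Σ-syntax; ∃-syntax; _×_; _,_; proj₁; proj₂; uncurry)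
open import Data.Sum as Sum using (_⊎_; inj₁; inj₂; [_,_]′)
open import Data.Empty using (⊥)
open import Data.Vec as Vec using (Vec; []; _∷_; lookup)
open import Data.Vec.Functional using (head; tail) renaming (_∷_ to _∷ᶠ_)
import Data.Vec.Properties as Vec
import Data.Vec.Membership.DecPropositional as VecMembership
open import Data.Vec.Relation.Unary.All using ([]; _∷_)
open import Data.Vec.Relation.Unary.AllPairs as AllPairs using (AllPairs; []; _∷_; allPairs?)
import Data.Vec.Relation.Unary.AllPairs.Properties as AllPairs
open import Data.Vec.Relation.Unary.Unique.Propositional using (Unique)
open import Data.Vec.Relation.Unary.Unique.Propositional.Properties using (lookup-injective)
open import Function using (_∘_; case_of_; id)
open import Function.Definitions using (Injective)
open import Relation.Binary.PropositionalEquality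
open import Relation.Nullary
open import Relation.Nullary.Decidable using (True; toWitness; map′; decidable-stable)
open import Defs
open EdgeColouring using (colour)

private variable
  a b k m n : ℕ

-- Injections into subsets of Fin n

EmbedsInto : ℕ → (Fin n → Set) → Set
EmbedsInto {n} a P = Σ[ e ∈ (Fin a → Fin n) ] Injective _≡_ _≡_ e × (∀ u → P (e u))

embed-lift : (P : Fin (suc n) → Set) → P zero → EmbedsInto a (P ∘ suc) → EmbedsInto (suc a) P
embed-lift P p₀ (e , e-inj , pe) = lift 1 e , lift-injective e e-inj 1 , λ { zero → p₀ ; (suc u) → pe u }

embed-suc : (P : Fin (suc n) → Set) → EmbedsInto a (P ∘ suc) → EmbedsInto a P
embed-suc P (e , e-inj , pe) = suc ∘ e , e-inj ∘ suc-injective , pe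

-- The points of `Fin n` are examined one by one. Each lowers `n` and one of `a`, `b` by one, so the
-- inequality survives; when no point is left, `a` or `b` must already be zero.
split : ∀ a b {n} {P : Fin n → Set} → (∀ u → Dec (P u)) → a + b ≤ suc n →
        EmbedsInto a P ⊎ EmbedsInto b (¬_ ∘ P)
split zero    b       P? _ = inj₁ ((λ ()) , (λ { {()} }) , λ ())
split (suc a) zero    P? _ = inj₂ ((λ ()) , (λ { {()} }) , λ ())
split (suc a) (suc b) {zero}  P? (s≤s le) = contradiction (≤-trans (m≤n+m (suc b) a) le) λ ()
split (suc a) (suc b) {suc n} {P} P? (s≤s le) with P? zero
... | yes p = Sum.map (embed-lift P p) (embed-suc (¬_ ∘ P)) (split a (suc b) (P? ∘ suc) le)
... | no ¬p = Sum.map (embed-suc P) (embed-lift (¬_ ∘ P) ¬p)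
                (split (suc a) b (P? ∘ suc) (subst (_≤ suc n) (+-suc a b) le))

-- If colour `zero` occurs at most `r` times, `split` leaves `suc (k * r)` points that avoid it, and
-- `punchOut` recolours them with `k` colours.
pigeonholes : ∀ r {k n} (f : Fin n → Fin k) → k * r < n → ∃[ j ] EmbedsInto (suc r) (λ u → f u ≡ j)
pigeonholes r {zero}  {suc n} f lt = contradiction (f zero) λ ()
pigeonholes r {suc k} {n} f lt
  with split (suc r) (suc (k * r)) (λ u → f u ≟ zero) (s≤s (subst (_≤ n) (sym (+-suc r (k * r))) lt))
... | inj₁ e = zero , e
... | inj₂ (i , i-inj , f≢0)
  with j , e , e-inj , f′≡j ← pigeonholes r (λ u → punchOut (f≢0 u ∘ sym)) ≤-refl
  = suc j , i ∘ e , e-inj ∘ i-inj , λ u → suc-of (e u) (f′≡j u)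
  where
  suc-of : ∀ u {j} → punchOut {i = zero} (f≢0 u ∘ sym) ≡ j → f (i u) ≡ suc j
  suc-of u refl with f (i u) | f≢0 u
  ... | zero  | 0≢0 = contradiction refl 0≢0
  ... | suc _ | _   = refl

avoid : (s : Fin k → Fin n) → k + a ≤ n → EmbedsInto a (λ v → ∀ i → s i ≢ v)
avoid {k} {a = a} s le with split (suc k) a (λ v → any? (λ i → s i ≟ v)) (s≤s le)
-- The `suc k` points hit by `s` would inject into its `k` indices.
... | inj₁ (e , e-inj , hit) = contradiction
      (injective⇒≤ {f = proj₁ ∘ hit} λ {u} {v} eq → e-inj (trans (sym (proj₂ (hit u))) (trans (cong s eq) (proj₂ (hit v)))))
      1+n≰n
... | inj₂ (e , e-inj , miss) = e , e-inj , λ u i eq → miss u (i , eq)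

-- Ramsey's theorem

restrict : EdgeColouring n k → (Fin m → Fin n) → EdgeColouring m k
restrict c e = record { colour = λ u v → colour c (e u) (e v) ; symm = λ u v → EdgeColouring.symm c (e u) (e v) }

MonoClique : EdgeColouring n k → Fin k → ℕ → Set
MonoClique {n} c i s = Σ[ e ∈ (Fin s → Fin n) ] Injective _≡_ _≡_ e × (∀ u v → u ≢ v → colour c (e u) (e v) ≡ i)

clique⇒copy : (c : EdgeColouring n k) (H : Graph) {i : Fin k} → MonoClique c i (Graph.order H) → HasMonochromaticCopy c H
clique⇒copy c H {i} (e , e-inj , mono) =
  (e , e-inj) , i , λ u v uv → mono u v λ u≡v → Graph.irrefl H u≡v uv

clique-restrict : (c : EdgeColouring n k) {e : Fin m → Fin n} → Injective _≡_ _≡_ e →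
                  ∀ {i s} → MonoClique (restrict c e) i s → MonoClique c i s
clique-restrict c {e} e-inj (f , f-inj , mono) = e ∘ f , f-inj ∘ e-inj , mono

clique-cons : (c : EdgeColouring (suc n) k) {i : Fin k} ((e , _) : EmbedsInto m (λ v → colour c zero (suc v) ≡ i)) →
              ∀ {s} → MonoClique (restrict c (suc ∘ e)) i s → MonoClique c i (suc s)
clique-cons c {i} (e , e-inj , adj) (f , f-inj , mono) =
  lift 1 (e ∘ f) , lift-injective (e ∘ f) (f-inj ∘ e-inj) 1 , λ where
    zero    zero    0≢0 → contradiction refl 0≢0
    zero    (suc v) _   → adj (f v)
    (suc u) zero    _   → trans (EdgeColouring.symm c _ _) (adj (f u))
    (suc u) (suc v) u≢v → mono u v (u≢v ∘ cong suc)

≢0⇒≡1 : ∀ {i : Fin 2} → i ≢ 0F → i ≡ 1F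
≢0⇒≡1 {0F} 0≢0 = contradiction refl 0≢0
≢0⇒≡1 {1F} _   = refl

-- The Erdős-Szekeres recursion: among the other vertices, either `n₀` are joined to vertex `zero`
-- in colour 0 or `n₁` in colour 1, and `zero` extends a clique found there.
ramsey : ∀ s t → ∃[ n ] ∀ (c : EdgeColouring n 2) → MonoClique c 0F s ⊎ MonoClique c 1F t
ramsey zero    t       = 0 , λ _ → inj₁ ((λ ()) , (λ { {()} }) , λ ())
ramsey (suc s) zero    = 0 , λ _ → inj₂ ((λ ()) , (λ { {()} }) , λ ())
ramsey (suc s) (suc t) with n₀ , r₀ ← ramsey s (suc t) | n₁ , r₁ ← ramsey (suc s) t = suc (n₀ + n₁) , clique
  where
  clique : ∀ c → MonoClique c 0F (suc s) ⊎ MonoClique c 1F (suc t)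
  clique c with split n₀ n₁ (λ v → colour c zero (suc v) ≟ 0F) (n≤1+n _)
  ... | inj₁ e@(i , i-inj , _) = Sum.map (clique-cons c e) (clique-restrict c (i-inj ∘ suc-injective))
          (r₀ (restrict c (suc ∘ i)))
  ... | inj₂ e@(i , i-inj , ≢0) = Sum.map (clique-restrict c (i-inj ∘ suc-injective)) (clique-cons c (i , i-inj , ≢0⇒≡1 ∘ ≢0))
          (r₁ (restrict c (suc ∘ i)))

-- Decidability of properties of all colourings

-- Functions have no decidable equality without extensionality, so search is
-- restricted to predicates respecting an equivalence.
Searchable : (A : Set) → (A → A → Set) → Set₁
Searchable A _≈_ = ∀ {P : A → Set} → (∀ {x y} → x ≈ y → P x → P y) → (∀ x → Dec (P x)) → Dec (∃[ x ] P x)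

Pointwise : {A : Set} → (A → A → Set) → (f g : Fin n → A) → Set
Pointwise _≈_ f g = ∀ u → f u ≈ g u

searchFin : Searchable (Fin n) _≡_
searchFin _ = any?

searchFunctions : ∀ {A : Set} {_≈_ : A → A → Set} → (∀ {x} → x ≈ x) → Searchable A _≈_ →
                  ∀ n → Searchable (Fin n → A) (Pointwise _≈_)
searchFunctions ≈-refl search zero resp P? =
  map′ (_ ,_) (λ (_ , p) → resp (λ ()) p) (P? λ ())
searchFunctions {_≈_ = _≈_} ≈-refl search (suc n) {P} resp P? =
  -- A function agrees with the one rebuilt from its head and tail only pointwise; `resp` bridges
  -- this gap.
  map′ (λ (x , f , p) → x ∷ᶠ f , p)
       (λ (f , p) → head f , tail f , resp (λ { zero → ≈-refl ; (suc _) → ≈-refl }) p)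
       (search (λ x≈y (f , p) → f , resp (λ { zero → x≈y ; (suc _) → ≈-refl }) p) λ x →
        searchFunctions ≈-refl search n (λ f≈g → resp (λ { zero → ≈-refl ; (suc u) → f≈g u })) λ f → P? (x ∷ᶠ f))

injective? : (f : Fin m → Fin n) → Dec (Injective _≡_ _≡_ f)
injective? f = map′ (λ inj {u} {v} → inj u v) (λ inj u v → inj)
  (all? λ u → all? λ v → (f u ≟ f v) →-dec (u ≟ v))

injective-resp : {f g : Fin m → Fin n} → f ≗ g → Injective _≡_ _≡_ f → Injective _≡_ _≡_ g
injective-resp f≗g f-inj eq = f-inj (trans (f≗g _) (trans eq (sym (f≗g _))))

anyCopy? : ∀ (H : Graph) {n} {P : (Fin (Graph.order H) → Fin n) → Set} →
           (∀ {f g} → f ≗ g → P f → P g) → (∀ f → Dec (P f)) → Dec (Σ[ (f , _) ∈ Copy H n ] P f)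
anyCopy? H {n} {P} resp P? = map′ to from
  (searchFunctions refl searchFin (Graph.order H) {Q} Q-resp λ f → injective? f ×-dec P? f)
  where
  Q : (Fin (Graph.order H) → Fin n) → Set
  Q f = Injective _≡_ _≡_ f × P f

  Q-resp : ∀ {f g} → f ≗ g → Q f → Q g
  Q-resp f≗g (f-inj , p) = injective-resp f≗g f-inj , resp f≗g p

  to : ∃[ f ] Q f → Σ[ (f , _) ∈ Copy H n ] P f
  to (f , f-inj , p) = (f , f-inj) , p

  from : Σ[ (f , _) ∈ Copy H n ] P f → ∃[ f ] Q f
  from ((f , f-inj) , p) = f , f-inj , p

_≗₂_ : EdgeColouring n k → EdgeColouring n k → Set
c ≗₂ d = ∀ u v → colour c u v ≡ colour d u v

module _ (c d : EdgeColouring n k) (c≗d : c ≗₂ d) {H : Graph} where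

  monochromatic-resp : HasMonochromaticCopy c H → HasMonochromaticCopy d H
  monochromatic-resp (φ , i , mono) = φ , i , λ u v uv → trans (sym (c≗d _ _)) (mono u v uv)

  rainbow-resp : HasRainbowCopy c H → HasRainbowCopy d H
  rainbow-resp (φ , rainbow) = φ , λ u v x y uv xy eq →
    rainbow u v x y uv xy (trans (c≗d _ _) (trans eq (sym (c≗d _ _))))

module _ (c : EdgeColouring n k) (H : Graph) where
  open Graph H

  cong-colour : {f g : Fin m → Fin n} → f ≗ g → ∀ u v → colour c (f u) (f v) ≡ colour c (g u) (g v)
  cong-colour f≗g u v = cong₂ (colour c) (f≗g u) (f≗g v)

  hasMonochromaticCopy? : Dec (HasMonochromaticCopy c H)
  hasMonochromaticCopy? = anyCopy? H
    (λ f≗g (i , mono) → i , λ u v uv → trans (sym (cong-colour f≗g u v)) (mono u v uv))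
    λ f → any? λ i → all? λ u → all? λ v → adj? u v →-dec (colour c (f u) (f v) ≟ i)

  hasRainbowCopy? : Dec (HasRainbowCopy c H)
  hasRainbowCopy? = anyCopy? H
    (λ f≗g rainbow u v x y uv xy eq →
       rainbow u v x y uv xy (trans (cong-colour f≗g u v) (trans eq (sym (cong-colour f≗g x y)))))
    λ f → all? λ u → all? λ v → all? λ x → all? λ y → adj? u v →-dec (adj? x y →-dec
      ((colour c (f u) (f v) ≟ colour c (f x) (f y)) →-dec
       (((u ≟ x) ×-dec (v ≟ y)) ⊎-dec ((u ≟ y) ×-dec (v ≟ x)))))

exact? : (c : EdgeColouring n k) → Dec (Exact c)
exact? c = all? λ i → any? λ u → any? λ v → ¬? (u ≟ v) ×-dec (colour c u v ≟ i)

-- The search is for a counterexample among raw functions, so `Bad` carries the symmetry proof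
-- itself.
allColourings? : ∀ {P : EdgeColouring n k → Set} → (∀ {c d} → c ≗₂ d → P c → P d) →
                 (∀ c → Dec (P c)) → Dec (∀ c → P c)
allColourings? {n} {k} {P} resp P? = map′ all-from none-from
  (¬? (searchFunctions (λ _ → refl) (searchFunctions refl searchFin n) n {Bad} bad-resp bad?))
  where
  Bad : (Fin n → Fin n → Fin k) → Set
  Bad f = Σ[ s ∈ (∀ u v → f u v ≡ f v u) ] ¬ P (record { colour = f ; symm = s })

  bad-resp : ∀ {f g} → Pointwise (Pointwise _≡_) f g → Bad f → Bad g
  bad-resp f≗g (s , ¬p) = (λ u v → trans (sym (f≗g u v)) (trans (s u v) (f≗g v u))) ,
    ¬p ∘ resp λ u v → sym (f≗g u v)

  bad? : ∀ f → Dec (Bad f)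
  bad? f with all? (λ u → all? λ v → f u v ≟ f v u)
  ... | no ¬s = no (¬s ∘ proj₁)
  ... | yes s with P? (record { colour = f ; symm = s })
  ...   | no ¬p = yes (s , ¬p)
  -- The proof of symmetry in a counterexample may differ from `s`; since `P` respects `≗₂`, it
  -- cannot tell them apart.
  ...   | yes p = no λ (_ , ¬p) → ¬p (resp (λ _ _ → refl) p)

  all-from : ¬ (∃[ f ] Bad f) → ∀ c → P c
  all-from none c = decidable-stable (P? c) λ ¬p → none (colour c , EdgeColouring.symm c , ¬p)

  none-from : (∀ c → P c) → ¬ (∃[ f ] Bad f)
  none-from all (_ , _ , ¬p) = ¬p (all _)

least : {P : ℕ → Set} → (∀ n → Dec (P n)) → ∀ {b} → P b → ∃[ n ] IsMinimum P n
least P? {zero}  p = 0 , p , λ _ _ → z≤n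
least {P} P? {suc b} p with P? 0
... | yes p₀ = 0 , p₀ , λ _ _ → z≤n
... | no ¬p₀ with n , pn , min ← least (P? ∘ suc) p =
  suc n , pn , λ { zero p₀ → contradiction p₀ ¬p₀ ; (suc m) pm → s≤s (min m pm) }

-- Rainbow four-edge subgraphs, by finite search

decide : {A : Set} (a? : Dec A) → True a? → A
decide _ = toWitness

unique? : ∀ {n} (xs : Vec (Fin n) k) → Dec (Unique xs)
unique? = allPairs? λ x y → ¬? (x ≟ y)

-- Four edges, as many as there are colours: a rainbow copy uses every colour exactly once, which
-- makes the relabelling by `κ` possible.
Shape : ℕ → Set
Shape k = Vec (Fin k × Fin k) 4

p₅ star fork : Shape 5
p₅   = (0F , 1F) ∷ (1F , 2F) ∷ (2F , 3F) ∷ (3F , 4F) ∷ []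
star = (0F , 1F) ∷ (0F , 2F) ∷ (0F , 3F) ∷ (0F , 4F) ∷ []
fork = (0F , 1F) ∷ (0F , 2F) ∷ (0F , 3F) ∷ (1F , 4F) ∷ []

paw : Shape 4
paw = (0F , 1F) ∷ (0F , 2F) ∷ (1F , 2F) ∷ (0F , 3F) ∷ []

edgeColour : {C : Set} → (Fin n → Fin n → C) → Shape k → (Fin k → Fin n) → Fin 4 → C
edgeColour h L s i = let (u , v) = lookup L i in h (s u) (s v)

RainbowShape : (Fin n → Fin n → Fin 4) → Shape k → Set
RainbowShape {n} {k} h L =
  Σ[ s ∈ (Fin k → Fin n) ] Injective _≡_ _≡_ s × Injective _≡_ _≡_ (edgeColour h L s)

injective⇒surjective : {f : Fin (suc n) → Fin (suc n)} → Injective _≡_ _≡_ f → ∀ y → ∃[ x ] f x ≡ y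
injective⇒surjective {f = f} inj y with any? (λ x → f x ≟ y)
... | yes hit = hit
... | no miss = contradiction
  (injective⇒≤ (λ {a} {b} eq → inj (punchOut-injective (miss ∘ (a ,_) ∘ sym) (miss ∘ (b ,_) ∘ sym) eq)))
  1+n≰n

PartialColouring : ℕ → Set
PartialColouring n = Fin n → Fin n → Maybe (Fin 4)

_⊑_ : PartialColouring n → (Fin n → Fin n → Fin 4) → Set
g ⊑ h = ∀ u v {c} → g u v ≡ just c → h u v ≡ c

SameEdge : (u v x y : Fin n) → Set
SameEdge u v x y = (u ≡ x × v ≡ y) ⊎ (u ≡ y × v ≡ x)

sameEdge? : ∀ (u v x y : Fin n) → Dec (SameEdge u v x y)
sameEdge? u v x y = ((u ≟ x) ×-dec (v ≟ y)) ⊎-dec ((u ≟ y) ×-dec (v ≟ x))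

-- Matching on the Boolean alone keeps the search from evaluating proofs.
paint : Fin n × Fin n → Fin 4 → PartialColouring n → PartialColouring n
paint (x , y) c g u v with sameEdge? u v x y
... | true  because _ = just c
... | false because _ = g u v

Step : ℕ → Set
Step n = (Fin n × Fin n) × List (Fin 4)

free : Fin n × Fin n → Step n
free e = e , allFin 4

paint-⊑ : ∀ {g : PartialColouring n} {h} → (∀ u v → h u v ≡ h v u) → g ⊑ h →
          ∀ e → paint e (uncurry h e) g ⊑ h
paint-⊑ h-sym g⊑h (x , y) u v eq with sameEdge? u v x y
paint-⊑ h-sym g⊑h (x , y) u v refl | yes (inj₁ (refl , refl)) = refl
paint-⊑ h-sym g⊑h (x , y) u v refl | yes (inj₂ (refl , refl)) = h-sym u v
... | no _ = g⊑h u v eq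

-- Backtracking along a list of edges with admissible colours: Forced says that
-- every branch reaches a partial colouring satisfying P.
module Search {P : PartialColouring n → Set} (P? : ∀ g → Dec (P g)) where

  Forced : List (Step n) → PartialColouring n → Set
  Forced []              g = P g
  Forced ((e , cs) ∷ es) g = P g ⊎ All (λ c → Forced es (paint e c g)) cs

  forced? : ∀ es g → Dec (Forced es g)
  forced? []              g = P? g
  forced? ((e , cs) ∷ es) g = P? g ⊎-dec All.all? (λ c → forced? es (paint e c g)) cs

  -- The total colouring `h` selects one branch: its colour on each listed edge is admissible, and
  -- painting that colour keeps the partial colouring below `h`.
  forced⇒ : ∀ {h} → (∀ u v → h u v ≡ h v u) → ∀ es {g} → Forced es g → g ⊑ h →
            All (λ (e , cs) → uncurry h e ∈ cs) es → ∃[ g′ ] P g′ × g′ ⊑ h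
  forced⇒ h-sym []       p         g⊑h []         = _ , p , g⊑h
  forced⇒ h-sym (_ ∷ _)  (inj₁ p)  g⊑h _          = _ , p , g⊑h
  forced⇒ h-sym (_ ∷ es) (inj₂ ps) g⊑h (he ∷ hes) =
    forced⇒ h-sym es (All.lookup ps he) (paint-⊑ h-sym g⊑h _) hes

-- Candidate placements of a shape on `k` vertices. They are only proposed here; `Found` certifies
-- distinctness itself.
sequences : ∀ k n → List (Vec (Fin n) k)
sequences zero    n = [] ∷ []
sequences (suc k) n = concatMap
  (λ s → List.map (_∷ s) (filter (λ v → ¬? (v ∈? s)) (allFin n))) (sequences k n)
  where open VecMembership _≟_ using (_∈?_)

-- An unpainted edge is apart from nothing, so a copy counts as found only once all its edges are
-- painted.
Apart : Maybe (Fin 4) → Maybe (Fin 4) → Set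
Apart (just c) (just d) = c ≢ d
Apart _        _        = ⊥

apart? : ∀ c d → Dec (Apart c d)
apart? (just c) (just d) = ¬? (c ≟ d)
apart? (just _) nothing  = no λ ()
apart? nothing  _        = no λ ()

module _ (ss : List (Vec (Fin n) k)) (L : Shape k) where

  ApartEdges : PartialColouring n → Vec (Fin n) k → Fin k × Fin k → Fin k × Fin k → Set
  ApartEdges g s (u , v) (x , y) = Apart (g (lookup s u) (lookup s v)) (g (lookup s x) (lookup s y))

  Found : PartialColouring n → Set
  Found g = Any (λ s → AllPairs (ApartEdges g s) L × Unique s) ss

  found? : ∀ g → Dec (Found g)
  found? g = Any.any? (λ s → allPairs? (λ _ _ → apart? _ _) L ×-dec unique? s) ss

  apart⇒≢ : ∀ {x y c d} → Apart x y → (∀ {b} → x ≡ just b → c ≡ b) → (∀ {b} → y ≡ just b → d ≡ b) → c ≢ d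
  apart⇒≢ {just _} {just _} a hx hy refl = a (trans (sym (hx refl)) (hy refl))

  found⇒rainbow : ∀ {g} {h : Fin n → Fin n → Fin 4} → g ⊑ h → Found g → RainbowShape h L
  found⇒rainbow {g} {h} g⊑h found with s , apart , s-uniq ← Any.satisfied found =
      lookup s , (λ {i} {j} → lookup-injective s-uniq i j)
    , λ {i} {j} eq → lookup-injective (unique s apart) i j
        (trans (Vec.lookup-map i _ L) (trans eq (sym (Vec.lookup-map j _ L))))
    where
    unique : ∀ s → AllPairs (ApartEdges g s) L → Unique (Vec.map (λ (u , v) → h (lookup s u) (lookup s v)) L)
    unique s = AllPairs.map⁺ ∘ AllPairs.map
      (λ {(u , v)} {(x , y)} a → apart⇒≢ a (g⊑h (lookup s u) (lookup s v)) (g⊑h (lookup s x) (lookup s y)))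

uncoloured : PartialColouring n
uncoloured _ _ = nothing

known : Shape n → List (Step n)
known L = List.tabulate (λ i → lookup L i , i ∷ [])

-- After permuting the colours, edge i of the rainbow copy of L has colour i, so
-- that a search only has to treat this one case.
module Relabelled (c : EdgeColouring n 4) (L : Shape k)
  {s : Fin k → Fin n} (s-inj : Injective _≡_ _≡_ s)
  (rainbow : Injective _≡_ _≡_ (edgeColour (colour c) L s)) where

  κ κ⁻¹ : Fin 4 → Fin 4
  κ     = edgeColour (colour c) L s
  κ⁻¹ x = proj₁ (injective⇒surjective rainbow x)

  κ-κ⁻¹ : ∀ x → κ (κ⁻¹ x) ≡ x
  κ-κ⁻¹ x = proj₂ (injective⇒surjective rainbow x)

  h : Fin k → Fin k → Fin 4
  h u v = κ⁻¹ (colour c (s u) (s v))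

  h-reflects : ∀ {u v x y} → h u v ≡ h x y → colour c (s u) (s v) ≡ colour c (s x) (s y)
  h-reflects eq = trans (sym (κ-κ⁻¹ _)) (trans (cong κ eq) (κ-κ⁻¹ _))

  h-sym : ∀ u v → h u v ≡ h v u
  h-sym u v = cong κ⁻¹ (EdgeColouring.symm c (s u) (s v))

  h-lookup : ∀ i → uncurry h (lookup L i) ≡ i
  h-lookup i = rainbow (κ-κ⁻¹ (κ i))

  Fits : Step k → Set
  Fits (e , cs) = uncurry h e ∈ cs

  known-fits : All Fits (known L)
  known-fits = All.tabulate⁺ {f = λ i → lookup L i , i ∷ []} (λ i → here (h-lookup i))

  free-fits : ∀ e → Fits (free e)
  free-fits e = ∈-allFin (uncurry h e)

  transport : ∀ {j} (M : Shape j) → RainbowShape h M → RainbowShape (colour c) M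
  transport M (w , w-inj , w-rainbow) = s ∘ w , w-inj ∘ s-inj , w-rainbow ∘ cong κ⁻¹

  module _ {P : PartialColouring k → Set} (P? : ∀ g → Dec (P g)) where
    open Search P?

    force : ∀ es → Forced (known L ++ es) uncoloured → All Fits es → ∃[ g ] P g × g ⊑ h
    force es forced fits = forced⇒ h-sym (known L ++ es) forced (λ _ _ ()) (All.++⁺ known-fits fits)

P₅⊎Paw : PartialColouring n → Set
P₅⊎Paw {n} g = Found (sequences 5 n) p₅ g ⊎ Found (sequences 4 n) paw g

p₅⊎paw? : (g : PartialColouring n) → Dec (P₅⊎Paw g)
p₅⊎paw? {n} g = found? (sequences 5 n) p₅ g ⊎-dec found? (sequences 4 n) paw g

starSteps forkSteps : List (Step 5)
starSteps = free (2F , 4F) ∷ free (1F , 3F) ∷ []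
forkSteps = ((0F , 4F) , 0F ∷ []) ∷ free (1F , 2F) ∷ []

-- Type checking `decide` runs the search; opacity keeps the resulting proof from being unfolded
-- later.
abstract
  star-forced : Search.Forced p₅⊎paw? (known star ++ starSteps) uncoloured
  star-forced = decide (Search.forced? p₅⊎paw? (known star ++ starSteps) uncoloured) _

  fork-forced : Search.Forced p₅⊎paw? (known fork ++ forkSteps) uncoloured
  fork-forced = decide (Search.forced? p₅⊎paw? (known fork ++ forkSteps) uncoloured) _

-- Consider the disjoint leaf pairs 24 and 13. A pair coloured like a spoke outside it closes a
-- triangle of a rainbow paw. Otherwise each pair has the colour of one of its own two spokes, and
-- exchanging that spoke for the pair on both sides gives a rainbow path.
star⇒p₅⊎paw : (c : EdgeColouring n 4) → RainbowShape (colour c) star →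
              RainbowShape (colour c) p₅ ⊎ RainbowShape (colour c) paw
star⇒p₅⊎paw c (s , s-inj , rainbow) =
  let g , found , g⊑h = force p₅⊎paw? starSteps star-forced
                          (free-fits _ ∷ free-fits _ ∷ [])
  in Sum.map (transport p₅ ∘ found⇒rainbow (sequences 5 5) p₅ g⊑h)
             (transport paw ∘ found⇒rainbow (sequences 4 5) paw g⊑h) found
  where open Relabelled c star s-inj rainbow

-- Edge 12 decides. In the colour of 01 it gives the path 3 0 2 1 4, in that of 02 the path 2 1 4 0
-- 3, where 04 replaces 01. In either other colour, triangle 012 is rainbow and 03 or 14 completes a
-- paw.
fork⇒p₅⊎paw : (c : EdgeColouring n 4) (r@(s , _) : RainbowShape (colour c) fork) →
              colour c (s 0F) (s 4F) ≡ colour c (s 0F) (s 1F) →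
              RainbowShape (colour c) p₅ ⊎ RainbowShape (colour c) paw
fork⇒p₅⊎paw c (s , s-inj , rainbow) eq =
  let g , found , g⊑h = force p₅⊎paw? forkSteps fork-forced
                          (here (trans (cong κ⁻¹ eq) (h-lookup 0F)) ∷ free-fits _ ∷ [])
  in Sum.map (transport p₅ ∘ found⇒rainbow (sequences 5 5) p₅ g⊑h)
             (transport paw ∘ found⇒rainbow (sequences 4 5) paw g⊑h) found
  where open Relabelled c fork s-inj rainbow

paw⁺ : Shape 6
paw⁺ = (0F , 1F) ∷ (0F , 2F) ∷ (1F , 2F) ∷ (0F , 3F) ∷ []

SameColour : PartialColouring n → (u v x y : Fin n) → Set
SameColour g u v x y = ∃[ c ] g u v ≡ just c × g x y ≡ just c

sameColour? : ∀ (g : PartialColouring n) u v x y → Dec (SameColour g u v x y)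
sameColour? g u v x y = any? λ c → (g u v ≟ᵐ just c) ×-dec (g x y ≟ᵐ just c)
  where _≟ᵐ_ = Maybe.≡-dec _≟_


p₅⊎same? : (g : PartialColouring 6) → Dec (Found (sequences 5 6) p₅ g ⊎ SameColour g 3F 4F 4F 5F)
p₅⊎same? g = found? (sequences 5 6) p₅ g ⊎-dec sameColour? g 3F 4F 4F 5F

pawSteps : List (Step 6)
pawSteps = free (3F , 4F) ∷ free (4F , 5F) ∷ free (1F , 4F) ∷ free (3F , 5F) ∷ free (2F , 5F) ∷ []

abstract
  paw-forced : Search.Forced p₅⊎same? (known paw⁺ ++ pawSteps) uncoloured
  paw-forced = decide (Search.forced? p₅⊎same? (known paw⁺ ++ pawSteps) uncoloured) _

-- Vertex 3 is the pendent one; 4 and 5 lie outside the paw. If 34 has the colour of 01 or 02, a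
-- rainbow path runs 4 3 0 and on through the triangle. The search over the other edges in
-- `pawSteps` settles the remaining colours.
paw⇒p₅⊎same : (c : EdgeColouring n 4) {s : Fin 6 → Fin n} → Injective _≡_ _≡_ s →
              Injective _≡_ _≡_ (edgeColour (colour c) paw⁺ s) →
              RainbowShape (colour c) p₅ ⊎ colour c (s 3F) (s 4F) ≡ colour c (s 4F) (s 5F)
paw⇒p₅⊎same c s-inj rainbow =
  let g , found , g⊑h = force p₅⊎same? pawSteps paw-forced
        (free-fits _ ∷ free-fits _ ∷ free-fits _ ∷ free-fits _ ∷ free-fits _ ∷ [])
  in Sum.map (transport p₅ ∘ found⇒rainbow (sequences 5 6) p₅ g⊑h)
             (λ (_ , e , e′) → h-reflects (trans (g⊑h _ _ e) (sym (g⊑h _ _ e′)))) found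
  where open Relabelled c paw⁺ s-inj rainbow

-- Colourings without a rainbow P₅

sameEdge-join : ∀ {u v x y e f : Fin n} → SameEdge u v e f → SameEdge x y e f → SameEdge u v x y
sameEdge-join (inj₁ (refl , refl)) (inj₁ (refl , refl)) = inj₁ (refl , refl)
sameEdge-join (inj₁ (refl , refl)) (inj₂ (refl , refl)) = inj₂ (refl , refl)
sameEdge-join (inj₂ (refl , refl)) (inj₁ (refl , refl)) = inj₂ (refl , refl)
sameEdge-join (inj₂ (refl , refl)) (inj₂ (refl , refl)) = inj₁ (refl , refl)

abstract
  pathEdge : ∀ u v → Graph.Adj (path 5) u v → ∃[ i ] uncurry (SameEdge u v) (lookup p₅ i)
  pathEdge = decide (all? λ u → all? λ v → Graph.adj? (path 5) u v →-dec
                     any? λ i → uncurry (sameEdge? u v) (lookup p₅ i)) _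

-- In `path 5` an edge appears as two ordered pairs, in `p₅` only once. Equally coloured pairs are
-- traced back to the same listed edge.
p₅⇒rainbowCopy : (c : EdgeColouring n 4) → RainbowShape (colour c) p₅ → HasRainbowCopy c (path 5)
p₅⇒rainbowCopy c (s , s-inj , rainbow) = (s , s-inj) , λ u v x y uv xy eq →
  let i , uv≈i = pathEdge u v uv
      j , xy≈j = pathEdge x y xy
      i≡j = rainbow {i} {j} (trans (sym (sameColour uv≈i)) (trans eq (sameColour xy≈j)))
  in sameEdge-join uv≈i (subst (uncurry (SameEdge x y) ∘ lookup p₅) (sym i≡j) xy≈j)
  where
  sameColour : ∀ {u v e f} → SameEdge u v e f → colour c (s u) (s v) ≡ colour c (s e) (s f)
  sameColour (inj₁ (refl , refl)) = refl
  sameColour (inj₂ (refl , refl)) = EdgeColouring.symm c _ _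

abstract
  -- The orders of the colours here and in `remainingColours` match those of the edges of `paw` and
  -- `fork` in the copies built below.
  fourthColour : ∀ (i j k : Fin 4) → i ≢ j → i ≢ k → j ≢ k → ∃[ l ] Unique (i ∷ j ∷ k ∷ l ∷ [])
  fourthColour = decide (all? λ i → all? λ j → all? λ k →
    ¬? (i ≟ j) →-dec (¬? (i ≟ k) →-dec (¬? (j ≟ k) →-dec any? λ l → unique? (i ∷ j ∷ k ∷ l ∷ [])))) _

  remainingColours : ∀ (i k : Fin 4) → i ≢ k → ∃[ l ] ∃[ m ] Unique (i ∷ l ∷ m ∷ k ∷ [])
  remainingColours = decide (all? λ i → all? λ k → ¬? (i ≟ k) →-dec
    any? λ l → any? λ m → unique? (i ∷ l ∷ m ∷ k ∷ [])) _

module _ (c : EdgeColouring n 4) where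

  Sees : Fin n → Fin 4 → Set
  Sees v i = ∃[ u ] u ≢ v × colour c v u ≡ i

  sees? : ∀ v i → Dec (Sees v i)
  sees? v i = any? λ u → ¬? (u ≟ v) ×-dec (colour c v u ≟ i)

  apartColours : ∀ {v x y i j} → colour c v x ≡ i → colour c v y ≡ j → i ≢ j → x ≢ y
  apartColours vx vy i≢j refl = i≢j (trans (sym vx) vy)

  rainbowShape : ∀ (L : Shape k) xs {is} → Unique xs → Unique is →
                 edgeColour (colour c) L (lookup xs) ≗ lookup is → RainbowShape (colour c) L
  rainbowShape L xs xs! is! eq = lookup xs , (λ {u} {v} → lookup-injective xs! u v) ,
    λ {i} {j} ij → lookup-injective is! i j (trans (sym (eq i)) (trans ij (eq j)))

  seesAll⇒star : ∀ {v} → (∀ i → Sees v i) → RainbowShape (colour c) star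
  seesAll⇒star {v} sees = rainbowShape star
    (v ∷ rep 0F ∷ rep 1F ∷ rep 2F ∷ rep 3F ∷ []) {0F ∷ 1F ∷ 2F ∷ 3F ∷ []}
    ((v≢ 0F ∷ v≢ 1F ∷ v≢ 2F ∷ v≢ 3F ∷ []) ∷
     (≢rep (λ ()) ∷ ≢rep (λ ()) ∷ ≢rep (λ ()) ∷ []) ∷
     (≢rep (λ ()) ∷ ≢rep (λ ()) ∷ []) ∷
     (≢rep (λ ()) ∷ []) ∷
     [] ∷ [])
    (decide (unique? _) _)
    λ { 0F → rep-colour 0F ; 1F → rep-colour 1F ; 2F → rep-colour 2F ; 3F → rep-colour 3F }
    where
    rep : Fin 4 → Fin n
    rep i = proj₁ (sees i)
    v≢ : ∀ i → v ≢ rep i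
    v≢ i = proj₁ (proj₂ (sees i)) ∘ sym
    rep-colour : ∀ i → colour c v (rep i) ≡ i
    rep-colour i = proj₂ (proj₂ (sees i))
    ≢rep : ∀ {i j} → i ≢ j → rep i ≢ rep j
    ≢rep = apartColours (rep-colour _) (rep-colour _)

  module _ {v k p q} (sees : ∀ i → i ≢ k → Sees v i) (p≢q : p ≢ q) (pq : colour c p q ≡ k)
           (p≢v : p ≢ v) (q≢v : q ≢ v) (vp≢k : colour c v p ≢ k) where

    -- The triangle on `v`, `p`, `q` has three colours. The fourth differs from `k`, so `v` sees it,
    -- and that edge is the pendent one.
    triangle⇒paw : colour c v q ≢ k → colour c v p ≢ colour c v q → RainbowShape (colour c) paw
    triangle⇒paw vq≢k vp≢vq
      with l , is!@((_ ∷ _ ∷ i≢l ∷ []) ∷ (_ ∷ j≢l ∷ []) ∷ (k≢l ∷ []) ∷ _) ← fourthColour _ _ _ vp≢vq vp≢k vq≢k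
      with x , x≢v , vx ← sees l (k≢l ∘ sym) = rainbowShape
        paw (v ∷ p ∷ q ∷ x ∷ [])
        ((p≢v ∘ sym ∷ q≢v ∘ sym ∷ x≢v ∘ sym ∷ []) ∷ (p≢q ∷ apartColours refl vx i≢l ∷ []) ∷
         (apartColours refl vx j≢l ∷ []) ∷ [] ∷ [])
        is! λ { 0F → refl ; 1F → refl ; 2F → pq ; 3F → vx }

    -- Besides `k` and the colour of `vp`, two colours remain, both seen by `v`. They give two
    -- spokes, `vp` is the third and `pq` the far edge of a fork; `vq` repeats the colour of `vp`,
    -- as `fork⇒p₅⊎paw` demands.
    triangle⇒p₅⊎paw : colour c v p ≡ colour c v q → RainbowShape (colour c) p₅ ⊎ RainbowShape (colour c) paw
    triangle⇒p₅⊎paw vp≡vq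
      with l , m , is!@((i≢l ∷ i≢m ∷ _ ∷ []) ∷ (l≢m ∷ l≢k ∷ []) ∷ (m≢k ∷ []) ∷ _) ← remainingColours _ _ vp≢k
      with x , x≢v , vx ← sees l l≢k | y , y≢v , vy ← sees m m≢k = fork⇒p₅⊎paw c (rainbowShape
        fork (v ∷ p ∷ x ∷ y ∷ q ∷ [])
        ((p≢v ∘ sym ∷ x≢v ∘ sym ∷ y≢v ∘ sym ∷ q≢v ∘ sym ∷ []) ∷
         (apartColours refl vx i≢l ∷ apartColours refl vy i≢m ∷ p≢q ∷ []) ∷
         (apartColours vx vy l≢m ∷ apartColours vx (sym vp≡vq) (i≢l ∘ sym) ∷ []) ∷
         (apartColours vy (sym vp≡vq) (i≢m ∘ sym) ∷ []) ∷ [] ∷ [])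
        is! λ { 0F → refl ; 1F → vx ; 2F → vy ; 3F → pq }) (sym vp≡vq)

  seesAllButOne : ∀ {v k} → (∀ i → i ≢ k → Sees v i) → Sees v k →
                  RainbowShape (colour c) p₅ ⊎ RainbowShape (colour c) paw
  seesAllButOne {k = k} sees seesk = star⇒p₅⊎paw c (seesAll⇒star λ i → case i ≟ k of λ where
    (yes refl) → seesk
    (no i≢k)   → sees i i≢k)

  -- Exactness supplies an edge `pq` of colour `k`. Either it shows that `v` sees `k` too, or both
  -- ends differ from `v` and neither is joined to `v` in colour `k`.
  seesThree⇒p₅⊎paw : Exact c → ∀ {v k} → (∀ i → i ≢ k → Sees v i) →
                     RainbowShape (colour c) p₅ ⊎ RainbowShape (colour c) paw
  seesThree⇒p₅⊎paw exact {v} {k} sees with p , q , p≢q , pq ← exact k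
    with p ≟ v | q ≟ v | colour c v p ≟ k | colour c v q ≟ k | colour c v p ≟ colour c v q
  ... | yes refl | _ | _ | _ | _ = seesAllButOne sees (q , p≢q ∘ sym , pq)
  ... | no _ | yes refl | _ | _ | _ = seesAllButOne sees (p , p≢q , trans (EdgeColouring.symm c q p) pq)
  ... | no p≢v | no _ | yes vp | _ | _ = seesAllButOne sees (p , p≢v , vp)
  ... | no _ | no q≢v | no _ | yes vq | _ = seesAllButOne sees (q , q≢v , vq)
  ... | no p≢v | no q≢v | no vp≢k | no vq≢k | no vp≢vq =
    inj₂ (triangle⇒paw sees p≢q pq p≢v q≢v vp≢k vq≢k vp≢vq)
  ... | no p≢v | no q≢v | no vp≢k | no _ | yes vp≡vq =
    triangle⇒p₅⊎paw sees p≢q pq p≢v q≢v vp≢k vp≡vq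

-- The vertices outside a rainbow paw

glue-injective : {f : Fin a → Fin n} {g : Fin b → Fin n} → Injective _≡_ _≡_ f → Injective _≡_ _≡_ g →
                 (∀ i j → f i ≢ g j) → Injective _≡_ _≡_ ([ f , g ]′ ∘ splitAt a)
glue-injective {a} {b = b} f-inj g-inj f≢g {x} {y} eq
  with splitAt a x in x≡ | splitAt a y in y≡
... | inj₁ i | inj₁ j = trans (sym (join-splitAt a b x)) (trans
        (cong (join a b) (trans x≡ (trans (cong inj₁ (f-inj eq)) (sym y≡)))) (join-splitAt a b y))
... | inj₂ i | inj₂ j = trans (sym (join-splitAt a b x)) (trans
        (cong (join a b) (trans x≡ (trans (cong inj₂ (g-inj eq)) (sym y≡)))) (join-splitAt a b y))
... | inj₁ i | inj₂ j = contradiction eq (f≢g i j)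
... | inj₂ i | inj₁ j = contradiction (sym eq) (f≢g j i)

-- Let b be the pendent vertex. For outside vertices x and y, the edges bx and xy agree in colour,
-- and so do by and yx. Hence all edges from b to the outside agree, and every outside edge has
-- their colour.
paw⇒clique : (c : EdgeColouring n 4) → ¬ RainbowShape (colour c) p₅ → RainbowShape (colour c) paw →
             ∀ t → 4 + suc t ≤ n → ∃[ i ] MonoClique c i (suc t)
paw⇒clique c no-p₅ (s , s-inj , rainbow) t le with e , e-inj , e-avoids ← avoid s le =
  colour c (s 3F) (e zero) , e , e-inj , λ u v u≢v → trans (sym (propagate u≢v)) (pendent u)
  where
  propagate : ∀ {u v} → u ≢ v → colour c (s 3F) (e u) ≡ colour c (e u) (e v)
  propagate {u} {v} u≢v = [ (λ p₅-copy → contradiction p₅-copy no-p₅) , id ]′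
    (paw⇒p₅⊎same c {[ s , e ∘ lookup (u ∷ v ∷ []) ]′ ∘ splitAt 4}
      (glue-injective s-inj (λ {x} {y} eq → lookup-injective ((u≢v ∷ []) ∷ [] ∷ []) x y (e-inj eq)) (λ i j → e-avoids _ i))
      λ {i} {j} eq → rainbow (trans (same i) (trans eq (sym (same j)))))
    where
    same : ∀ i → edgeColour (colour c) paw s i ≡
                 edgeColour (colour c) paw⁺ ([ s , e ∘ lookup (u ∷ v ∷ []) ]′ ∘ splitAt 4) i
    same = λ { 0F → refl ; 1F → refl ; 2F → refl ; 3F → refl }

  pendent : ∀ u → colour c (s 3F) (e u) ≡ colour c (s 3F) (e zero)
  pendent u with u ≟ zero
  ... | yes refl = refl
  ... | no u≢0 = trans (propagate u≢0) (trans (EdgeColouring.symm c _ _) (sym (propagate (u≢0 ∘ sym))))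

-- Colourings in which every vertex sees at most two colours

-- An unordered set of one or two colours.
Palette : Set
Palette = Fin 4 × Fin 4

_∈ₚ_ : Fin 4 → Palette → Set
i ∈ₚ (p , q) = i ≡ p ⊎ i ≡ q

_∈ₚ?_ : ∀ i P → Dec (i ∈ₚ P)
i ∈ₚ? (p , q) = (i ≟ p) ⊎-dec (i ≟ q)

Meet : Palette → Palette → Set
Meet P Q = ∃[ i ] i ∈ₚ P × i ∈ₚ Q

meet? : ∀ P Q → Dec (Meet P Q)
meet? P Q = any? λ i → (i ∈ₚ? P) ×-dec (i ∈ₚ? Q)

allPalettes? : ∀ {R : Palette → Set} → (∀ P → Dec (R P)) → Dec (∀ P → R P)
allPalettes? R? = map′ (λ r (p , q) → r p q) (λ r p q → r (p , q)) (all? λ p → all? λ q → R? (p , q))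

abstract
  -- Pairwise meeting sets of at most two colours share a colour or lie within three colours. These
  -- four cover all colours, so they share some `α`, and each other colour occurs beside it. A set
  -- `Q` without `α` would need three colours to meet them all. Each `Meet` follows directly on its
  -- palettes, so that the search prunes early.
  commonColour : ∀ P₀ → 0F ∈ₚ P₀ → ∀ P₁ → 1F ∈ₚ P₁ → Meet P₀ P₁ →
                 ∀ P₂ → 2F ∈ₚ P₂ → Meet P₀ P₂ → Meet P₁ P₂ →
                 ∀ P₃ → 3F ∈ₚ P₃ → Meet P₀ P₃ → Meet P₁ P₃ → Meet P₂ P₃ →
                 ∃[ α ] ∀ Q → Meet Q P₀ → Meet Q P₁ → Meet Q P₂ → Meet Q P₃ → α ∈ₚ Q
  commonColour = decide
    (allPalettes? λ P₀ → (0F ∈ₚ? P₀) →-dec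
     allPalettes? λ P₁ → (1F ∈ₚ? P₁) →-dec (meet? P₀ P₁ →-dec
     allPalettes? λ P₂ → (2F ∈ₚ? P₂) →-dec (meet? P₀ P₂ →-dec (meet? P₁ P₂ →-dec
     allPalettes? λ P₃ → (3F ∈ₚ? P₃) →-dec (meet? P₀ P₃ →-dec (meet? P₁ P₃ →-dec (meet? P₂ P₃ →-dec
     any? λ α → allPalettes? λ Q → meet? Q P₀ →-dec (meet? Q P₁ →-dec (meet? Q P₂ →-dec (meet? Q P₃ →-dec
     (α ∈ₚ? Q))))))))))) _

  -- Indexing the second colour through `punchIn α` leaves three classes of vertices, the source of
  -- the factor 3 in the upper bound.
  otherColour : ∀ α P → α ∈ₚ P → ∃[ j ] ∀ i → i ∈ₚ P → i ≡ α ⊎ i ≡ punchIn α j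
  otherColour = decide (all? λ α → allPalettes? λ P → (α ∈ₚ? P) →-dec
    any? λ (j : Fin 3) → all? λ i → (i ∈ₚ? P) →-dec ((i ≟ α) ⊎-dec (i ≟ punchIn α j))) _

  coveringPalette : ∀ i j → i ≢ j → ∃[ p ] ∃[ q ] ∀ k → k ≢ i → k ≢ j → k ∈ₚ (p , q)
  coveringPalette = decide (all? λ i → all? λ j → ¬? (i ≟ j) →-dec
    any? λ p → any? λ q → all? λ k → ¬? (k ≟ i) →-dec (¬? (k ≟ j) →-dec (k ∈ₚ? (p , q)))) _

Dominant : EdgeColouring n 4 → Fin 4 → Set
Dominant {n} c α = Σ[ f ∈ (Fin n → Fin 3) ] ∀ v u → u ≢ v → colour c v u ≡ α ⊎ colour c v u ≡ punchIn α (f v)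

module _ (c : EdgeColouring n 4) (exact : Exact c) where

  palettes⇒dominant : (P : Fin n → Palette) → (∀ v u → u ≢ v → colour c v u ∈ₚ P v) → ∃[ α ] Dominant c α
  palettes⇒dominant P local = α , (λ v → proj₁ (other v)) , λ v u u≢v → proj₂ (other v) _ (local v u u≢v)
    where
    vertex : Fin 4 → Fin n
    vertex i = proj₁ (exact i)

    vertex-sees : ∀ i → i ∈ₚ P (vertex i)
    vertex-sees i with v , u , v≢u , vu ← exact i = subst (_∈ₚ P v) vu (local v u (v≢u ∘ sym))

    meet : ∀ u v → Meet (P u) (P v)
    meet u v with u ≟ v
    ... | yes refl = _ , inj₁ refl , inj₁ refl
    -- The colour of the edge `uv` itself lies in both palettes.
    ... | no u≢v = colour c u v , local u v (u≢v ∘ sym) , subst (_∈ₚ P v) (EdgeColouring.symm c v u) (local v u u≢v)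

    common : ∃[ α ] ∀ Q → Meet Q _ → Meet Q _ → Meet Q _ → Meet Q _ → α ∈ₚ Q
    common = commonColour
      (P (vertex 0F)) (vertex-sees 0F)
      (P (vertex 1F)) (vertex-sees 1F) (meet _ _)
      (P (vertex 2F)) (vertex-sees 2F) (meet _ _) (meet _ _)
      (P (vertex 3F)) (vertex-sees 3F) (meet _ _) (meet _ _) (meet _ _)

    α = proj₁ common

    other : ∀ v → ∃[ j ] ∀ i → i ∈ₚ P v → i ≡ α ⊎ i ≡ punchIn α j
    other v = otherColour α (P v) (proj₂ common (P v) (meet _ _) (meet _ _) (meet _ _) (meet _ _))

  seesAllBut? : ∀ v k → Dec (∀ i → i ≢ k → Sees c v i)
  seesAllBut? v k = all? λ i → ¬? (i ≟ k) →-dec sees? c v i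

  missing : ∀ {v k} → ¬ (∀ i → i ≢ k → Sees c v i) → ∃[ i ] i ≢ k × ¬ Sees c v i
  missing {v} {k} ¬all with i , ¬imp ← ¬∀⟶∃¬ 4 _ (λ i → ¬? (i ≟ k) →-dec sees? c v i) ¬all =
    i , (λ i≡k → ¬imp λ i≢k → contradiction i≡k i≢k) , λ s → ¬imp λ _ → s

  fewColours⇒dominant : (∀ v → ¬ (∃[ k ] ∀ i → i ≢ k → Sees c v i)) → ∃[ α ] Dominant c α
  fewColours⇒dominant few = palettes⇒dominant (λ v → let p , q , _ = palette v in p , q) λ v → proj₂ (proj₂ (palette v))
    where
    palette : ∀ v → ∃[ p ] ∃[ q ] ∀ u → u ≢ v → colour c v u ∈ₚ (p , q)
    -- Exempting an arbitrary colour, here `0F`, yields an unseen colour `i`; exempting `i` then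
    -- yields a second one.
    palette v with i , _ , ¬seesi ← missing (λ all → few v (0F , all))
      with j , j≢i , ¬seesj ← missing (λ all → few v (i , all))
      with p , q , cover ← coveringPalette i j (j≢i ∘ sym) =
      p , q , λ u u≢v → cover _ (λ eq → ¬seesi (u , u≢v , eq)) (λ eq → ¬seesj (u , u≢v , eq))

indicator : Fin 4 → Fin 4 → Fin 2
indicator α i with i ≟ α
... | yes _ = 0F
... | no _  = 1F

indicator-reflects : ∀ α {β i} → i ≡ α ⊎ i ≡ β → i ≡ lookup (α ∷ β ∷ []) (indicator α i)
indicator-reflects α {i = i} i∈ with i ≟ α | i∈
... | yes i≡α | _        = i≡α
... | no _    | inj₂ i≡β = i≡β
... | no i≢α  | inj₁ i≡α = contradiction i≡α i≢α

-- With `suc r` as the Ramsey bound, `3 * r < n` is just what the pigeonhole principle asks for to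
-- put `suc r` vertices in one class, whose edges use only two colours.
dominant⇒copy : ∀ {H r} → (∀ (c : EdgeColouring (suc r) 2) → HasMonochromaticCopy c H) →
                (c : EdgeColouring n 4) → 3 * r < n → ∀ {α} → Dominant c α → HasMonochromaticCopy c H
dominant⇒copy {H = H} {r} ramsey₂ c lt {α} (f , two)
  with j , e , e-inj , e∈j ← pigeonholes r f lt
  with (φ , φ-inj) , i , mono ← ramsey₂ (record
         { colour = λ u v → indicator α (colour c (e u) (e v))
         ; symm   = λ u v → cong (indicator α) (EdgeColouring.symm c (e u) (e v)) })
  = (e ∘ φ , φ-inj ∘ e-inj) , lookup (α ∷ punchIn α j ∷ []) i , λ u v uv → trans
      (indicator-reflects α (subst (λ x → _ ≡ α ⊎ _ ≡ punchIn α x) (e∈j (φ u))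
        (two (e (φ u)) (e (φ v)) (λ eq → Graph.irrefl H (φ-inj (e-inj (sym eq))) uv))))
      (cong (lookup (α ∷ punchIn α j ∷ [])) (mono u v uv))

-- The upper bound for a single order

HasCopy : (n : ℕ) (H : Graph) → Set
HasCopy n H = ∀ (c : EdgeColouring n 4) → Exact c → HasRainbowCopy c (path 5) ⊎ HasMonochromaticCopy c H

largeHasCopy : ∀ H {r t} → Graph.order H ≡ suc t → (∀ (c : EdgeColouring (suc r) 2) → HasMonochromaticCopy c H) →
               3 * r < n → 4 + suc t ≤ n → HasCopy n H
largeHasCopy H {t = t} order ramsey₂ lt le c exact = case hasRainbowCopy? c (path 5) of λ where
    (yes rainbow)  → inj₁ rainbow
    (no  ¬rainbow) → inj₂ (monochromatic (¬rainbow ∘ p₅⇒rainbowCopy c))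
  where
  fromPaw : ¬ RainbowShape (colour c) p₅ → RainbowShape (colour c) paw → HasMonochromaticCopy c H
  fromPaw no-p₅ paw-copy =
    let i , clique = paw⇒clique c no-p₅ paw-copy t le
    in clique⇒copy c H (subst (MonoClique c i) (sym order) clique)

  monochromatic : ¬ RainbowShape (colour c) p₅ → HasMonochromaticCopy c H
  monochromatic no-p₅ = case any? (λ v → any? (seesAllBut? c exact v)) of λ where
    (yes (_ , _ , sees)) → [ (λ p₅-copy → contradiction p₅-copy no-p₅) , fromPaw no-p₅ ]′
                             (seesThree⇒p₅⊎paw c exact sees)
    (no few) → dominant⇒copy {H = H} ramsey₂ c lt
                 (proj₂ (fewColours⇒dominant c exact λ v (k , sees) → few (v , k , sees)))

-- The lower bound: a blow-up with monochromatic blocks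

-- Three blocks suffice to show the colours 1, 2 and 3; all blocks from the third on share colour 3.
blockColour : Fin a → Fin 4
blockColour zero          = 1F
blockColour (suc zero)    = 2F
blockColour (suc (suc _)) = 3F

blockColour≢0 : (i : Fin a) → blockColour i ≢ 0F
blockColour≢0 zero          ()
blockColour≢0 (suc zero)    ()
blockColour≢0 (suc (suc _)) ()

betweenBlocks : Fin a → Fin a → Fin 4
betweenBlocks i j with i ≟ j
... | yes _ = blockColour i
... | no _  = 0F

betweenBlocks-sym : (i j : Fin a) → betweenBlocks i j ≡ betweenBlocks j i
betweenBlocks-sym i j with i ≟ j | j ≟ i
... | yes refl | yes _ = refl
... | yes i≡j  | no j≢i = contradiction (sym i≡j) j≢i
... | no i≢j   | yes j≡i = contradiction (sym j≡i) i≢j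
... | no _     | no _  = refl

betweenBlocks-≡ : ∀ (i j : Fin a) → i ≡ j → betweenBlocks i j ≡ blockColour i
betweenBlocks-≡ i j i≡j with i ≟ j
... | yes _  = refl
... | no i≢j = contradiction i≡j i≢j

betweenBlocks≢0 : ∀ (i j : Fin a) → betweenBlocks i j ≢ 0F → i ≡ j
betweenBlocks≢0 i j ≢0 with i ≟ j
... | yes i≡j = i≡j
... | no _    = contradiction refl ≢0

block : ∀ a b → Fin (a * b) → Fin a
block a b = proj₁ ∘ remQuot {a} b

position : ∀ a b → Fin (a * b) → Fin b
position a b = proj₂ ∘ remQuot {a} b

block-combine : ∀ (i : Fin a) (x : Fin b) → block a b (combine i x) ≡ i
block-combine i x = cong proj₁ (remQuot-combine i x)

blocks : ∀ a b → EdgeColouring (a * b) 4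
blocks a b = record
  { colour = λ u v → betweenBlocks (block a b u) (block a b v)
  ; symm   = λ u v → betweenBlocks-sym (block a b u) (block a b v)
  }

position-injective : ∀ {u v} → block a b u ≡ block a b v → position a b u ≡ position a b v → u ≡ v
position-injective {a} {b} {u} {v} same pos = trans (sym (combine-remQuot {a} b u))
  (trans (cong₂ combine same pos) (combine-remQuot {a} b v))

combine≢ : ∀ (i j : Fin a) (x y : Fin b) → (i , x) ≢ (j , y) → combine i x ≢ combine j y
combine≢ i j x y ≢ eq = ≢ (trans (sym (remQuot-combine i x)) (trans (cong (remQuot _) eq) (remQuot-combine j y)))

blocks-exact : 3 ≤ a → 2 ≤ b → Exact (blocks a b)
blocks-exact {a} {b} (s≤s (s≤s _)) (s≤s (s≤s _)) 0F =
  combine {a} {b} 0F 0F , combine {a} {b} 1F 0F , combine≢ {a} {b} 0F 1F 0F 0F (λ ()) ,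
  cong₂ betweenBlocks (block-combine {a} {b} 0F 0F) (block-combine {a} {b} 1F 0F)
blocks-exact {a} {b} 3≤a (s≤s (s≤s _)) (suc i) =
  combine {a} {b} j 0F , combine {a} {b} j 1F , combine≢ {a} {b} j j 0F 1F (λ ()) , trans
    (cong₂ betweenBlocks (block-combine {a} {b} j 0F) (block-combine {a} {b} j 1F))
    (trans (betweenBlocks-≡ j j refl) (blockColour-inject 3≤a i))
  where
  j : Fin a
  j = inject≤ i 3≤a

  blockColour-inject : ∀ {a} (3≤a : 3 ≤ a) i → blockColour (inject≤ i 3≤a) ≡ suc i
  blockColour-inject (s≤s _)             0F = refl
  blockColour-inject (s≤s (s≤s _))       1F = refl
  blockColour-inject (s≤s (s≤s (s≤s _))) 2F = refl

blocks-adjacent : ∀ a b u v w → colour (blocks a b) u v ≢ 0F → colour (blocks a b) v w ≢ 0F →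
                  colour (blocks a b) u v ≡ colour (blocks a b) v w
blocks-adjacent a b u v w uv vw = trans (betweenBlocks-≡ _ _ u≡v) (trans (cong blockColour u≡v) (sym (betweenBlocks-≡ _ _ v≡w)))
  where
  u≡v = betweenBlocks≢0 (block a b u) (block a b v) uv
  v≡w = betweenBlocks≢0 (block a b v) (block a b w) vw

blocks-noRainbow : ∀ a b → ¬ HasRainbowCopy (blocks a b) (path 5)
blocks-noRainbow a b ((φ , _) , rainbow) =
  twoZeros (consecutive 0F 1F 2F (inj₁ refl) (inj₁ refl) (λ ()) (λ ()))
           (consecutive 2F 3F 4F (inj₁ refl) (inj₁ refl) (λ ()) (λ ()))
  where
  open Graph (path 5) using (Adj)
  c : Fin 5 → Fin 5 → Fin 4
  c u v = colour (blocks a b) (φ u) (φ v)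

  distinct : ∀ u v x y → Adj u v → Adj x y → u ≢ x → u ≢ y → c u v ≡ 0F → c x y ≢ 0F
  distinct u v x y uv xy u≢x u≢y p q with rainbow u v x y uv xy (trans p (sym q))
  ... | inj₁ (u≡x , _) = u≢x u≡x
  ... | inj₂ (u≡y , _) = u≢y u≡y

  consecutive : ∀ u v w → Adj u v → Adj v w → u ≢ v → u ≢ w → c u v ≡ 0F ⊎ c v w ≡ 0F
  consecutive u v w uv vw u≢v u≢w with c u v ≟ 0F | c v w ≟ 0F
  ... | yes uv≡0 | _        = inj₁ uv≡0
  ... | no _     | yes vw≡0 = inj₂ vw≡0
  ... | no uv≢0  | no vw≢0
    with rainbow u v v w uv vw (blocks-adjacent a b _ _ _ uv≢0 vw≢0)
  ...   | inj₁ (u≡v , _) = contradiction u≡v u≢v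
  ...   | inj₂ (u≡w , _) = contradiction u≡w u≢w

  twoZeros : c 0F 1F ≡ 0F ⊎ c 1F 2F ≡ 0F → ¬ (c 2F 3F ≡ 0F ⊎ c 3F 4F ≡ 0F)
  twoZeros (inj₁ p) (inj₁ q) = distinct 0F 1F 2F 3F (inj₁ refl) (inj₁ refl) (λ ()) (λ ()) p q
  twoZeros (inj₁ p) (inj₂ q) = distinct 0F 1F 3F 4F (inj₁ refl) (inj₁ refl) (λ ()) (λ ()) p q
  twoZeros (inj₂ p) (inj₁ q) = distinct 1F 2F 2F 3F (inj₁ refl) (inj₁ refl) (λ ()) (λ ()) p q
  twoZeros (inj₂ p) (inj₂ q) = distinct 1F 2F 3F 4F (inj₁ refl) (inj₁ refl) (λ ()) (λ ()) p q

-- In colour 0 the `suc a` clique vertices would lie in different blocks, of which there are `a`. In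
-- another colour, all `suc b` vertices would lie in the block of vertex `zero`, which is adjacent
-- to every other one, but a block has `b` positions.
blocks-noMonochromatic : ∀ {a b} → suc a ≤ suc b → ¬ HasMonochromaticCopy (blocks a b) (pineapple (suc b) (suc a))
blocks-noMonochromatic {a} {b} ω≤t ((φ , φ-inj) , i , mono) with i ≟ 0F
... | yes refl = contradiction (injective⇒≤ clique-injective) 1+n≰n
  where
  ι : Fin (suc a) → Fin (suc b)
  ι u = inject≤ u ω≤t

  inClique : ∀ u → toℕ (ι u) < suc a
  inClique u = subst (_< suc a) (sym (toℕ-inject≤ u ω≤t)) (toℕ<n u)

  clique-injective : Injective _≡_ _≡_ (block a b ∘ φ ∘ ι)
  clique-injective {u} {v} same with u ≟ v
  ... | yes u≡v = u≡v
  ... | no u≢v  = contradiction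
    (trans (sym (betweenBlocks-≡ _ _ same))
           (mono (ι u) (ι v) (u≢v ∘ inject≤-injective ω≤t ω≤t u v , inj₁ (inClique u , inClique v))))
    (blockColour≢0 _)
... | no i≢0 = contradiction
    (injective⇒≤ (λ {u} {v} → φ-inj ∘ position-injective {a} {b} (trans (sym (sameBlock u)) (sameBlock v))))
    1+n≰n
  where
  adjacent : ∀ v → zero ≢ v → Graph.Adj (pineapple (suc b) (suc a)) zero v
  adjacent v 0≢v with toℕ v <? suc a
  ... | yes v<ω = 0≢v , inj₁ (z<s , v<ω)
  ... | no v≮ω  = 0≢v , inj₂ (inj₁ (refl , ≮⇒≥ v≮ω))

  sameBlock : ∀ v → block a b (φ zero) ≡ block a b (φ v)
  sameBlock v with zero ≟ v
  ... | yes refl = refl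
  ... | no 0≢v = betweenBlocks≢0 _ _ (i≢0 ∘ trans (sym (mono zero v (adjacent v 0≢v))))

-- Existence of the two numbers

HasCopies : Graph → ℕ → Set
HasCopies H N = ∀ n → n ≥ N → HasCopy n H

hasCopy? : ∀ H n → Dec (HasCopy n H)
hasCopy? H n = allColourings?
  (λ {c} {d} c≗d copy exact → Sum.map (rainbow-resp c d c≗d {path 5}) (monochromatic-resp c d c≗d {H})
     (copy λ i → let u , v , u≢v , uv = exact i in u , v , u≢v , trans (c≗d u v) uv))
  λ c → exact? c →-dec (hasRainbowCopy? c (path 5) ⊎-dec hasMonochromaticCopy? c H)

-- The known bound `b` settles every `n` from `b` on, so only finitely many orders are left to
-- check.
hasCopies? : ∀ H {b} → HasCopies H b → ∀ N → Dec (HasCopies H N)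
hasCopies? H {b} large N = map′
  (λ small n N≤n → case n <? b of λ where
    (yes n<b) → small n<b N≤n
    (no n≮b)  → large n (≮⇒≥ n≮b))
  (λ copies {n} _ N≤n → copies n N≤n)
  (allUpTo? (λ n → (N ≤? n) →-dec hasCopy? H n) b)

∃R₂ : ∀ H → ∃[ R ] IsR₂ H R
∃R₂ H with n , cliques ← ramsey (Graph.order H) (Graph.order H) = least
  (λ n → allColourings? (λ {c} {d} c≗d → monochromatic-resp c d c≗d {H}) λ c → hasMonochromaticCopy? c H)
  {n} λ c → [ clique⇒copy c H , clique⇒copy c H ]′ (cliques c)

-- Even the constant colouring must contain a copy, and a copy is an injection.
order≤R₂ : ∀ H {R} → IsR₂ H R → Graph.order H ≤ R
order≤R₂ H (copy , _) = injective⇒≤ (proj₂ (proj₁ (copy (record { colour = λ _ _ → 0F ; symm = λ _ _ → refl }))))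

n≤1+nC2 : ∀ n → n ≤ suc n C 2
n≤1+nC2 n = begin
  n             ≡⟨ nC1≡n n ⟨
  n C 1         ≤⟨ m≤m+n (n C 1) (n C 2) ⟩
  n C 1 + n C 2 ≡⟨ nCk+nC[k+1]≡[n+1]C[k+1] n 1 ⟩
  suc n C 2     ∎
  where open ≤-Reasoning

3*[1+n]∸2 : ∀ n → 3 * suc n ∸ 2 ≡ suc (3 * n)
3*[1+n]∸2 n = cong (_∸ 2) (*-suc 3 n)

-- The two bounds for the pineapple with `t = suc b` and `ω = suc a`

module _ {a b : ℕ} (5≤a : 5 ≤ a) (1+a≤b : suc a ≤ b) where

  H : Graph
  H = pineapple (suc b) (suc a)

  upper : ∀ {r} → IsR₂ H (suc r) → 4 ≤ (3 * suc r ∸ 2) C 2 × HasCopies H (3 * suc r ∸ 2)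
  upper {r} isR₂@(copy , _) rewrite 3*[1+n]∸2 r =
      ≤-trans 4≤3r (n≤1+nC2 (3 * r))
    , λ n 3r<n → largeHasCopy H refl copy 3r<n (≤-trans 5+b≤1+3r 3r<n)
    where
    b≤r : b ≤ r
    b≤r = s≤s⁻¹ (order≤R₂ H isR₂)

    4≤r : 4 ≤ r
    4≤r = ≤-trans (≤-trans (n≤1+n 4) 5≤a) (≤-trans (n≤1+n a) (≤-trans 1+a≤b b≤r))

    4≤3r : 4 ≤ 3 * r
    4≤3r = ≤-trans 4≤r (m≤m+n r _)

    -- Outside the four vertices of the paw there must be room for a clique on `suc b` vertices.
    5+b≤1+3r : 5 + b ≤ suc (3 * r)
    5+b≤1+3r = s≤s (+-mono-≤ 4≤r (≤-trans b≤r (m≤m+n r _)))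

  lower : ∀ {N} → Isgr 4 (path 5) H N → a * b + 1 ≤ N
  -- If `N ≤ a * b`, the defining property of `N` would apply to the block colouring itself.
  lower {N} ((_ , copies) , _) = subst (_≤ N) (+-comm 1 (a * b)) (≰⇒> λ N≤ab →
    [ blocks-noRainbow a b , blocks-noMonochromatic (≤-trans 1+a≤b (n≤1+n b)) ]′
      (copies (a * b) N≤ab (blocks a b) (blocks-exact 3≤a 2≤b)))
    where
    3≤a : 3 ≤ a
    3≤a = ≤-trans (m≤n+m 3 2) 5≤a

    2≤b : 2 ≤ b
    2≤b = ≤-trans (≤-trans (m≤n+m 2 1) 3≤a) (≤-trans (n≤1+n a) 1+a≤b)

  ∃gr : ∀ {N} → 4 ≤ N C 2 × HasCopies H N → ∃[ gr ] Isgr 4 (path 5) H gr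
  ∃gr large = least (λ N → (4 ≤? N C 2) ×-dec hasCopies? H (proj₂ large) N) large

  bounds : ∃[ R ] IsR₂ H R →
    ∃[ R ] ∃[ gr ] (IsR₂ H R × Isgr 4 (path 5) H gr × a * b + 1 ≤ gr × gr ≤ 3 * R ∸ 2)
  bounds (zero  , isR₂) = contradiction (order≤R₂ H isR₂) λ ()
  bounds (suc r , isR₂) = bounded (∃gr (upper isR₂))
    where
    bounded : ∃[ gr ] Isgr 4 (path 5) H gr → _
    bounded (gr , isgr) = suc r , gr , isR₂ , isgr , lower isgr , proj₂ isgr _ (upper isR₂)

theorem4p5 : ∀ (t ω : ℕ) → ω ≥ 6 → t ≥ ω + 1 →
    ∃[ R ] ∃[ gr ]
    ( IsR₂ (pineapple t ω) R
    × Isgr 4 (path 5) (pineapple t ω) gr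
    × (ω ∸ 1) * (t ∸ 1) + 1 ≤ gr
    × gr ≤ 3 * R ∸ 2 )
theorem4p5 zero ω ω≥6 t≥ω+1 = contradiction (≤-trans (m≤n+m 1 ω) t≥ω+1) λ ()
theorem4p5 (suc b) (suc a) (s≤s 5≤a) (s≤s a+1≤b) =
  bounds 5≤a (subst (_≤ b) (+-comm a 1) a+1≤b) (∃R₂ (pineapple (suc b) (suc a)))
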